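{- Let $n\ge2$ and let $\alpha$ be an ordinal. (a) Every first-order $\mathcal L_{n,S}$-formula over $\mathfrak T_\alpha^n$ can be translated into an MSO formula over $(\alpha,<)$: for every $\mathcal L_{n,S}$-formula $\varphi(x_1,\dots,x_k)$ there is an MSO formula $\varphi^*(\bar X^1,\dots,\bar X^k)$, with each $\bar X^j$ an $n$-tuple of set variables, such that for all nodes $s_1,\dots,s_k$ of $\mathfrak T_\alpha^n$, $\mathfrak T_\alpha^n\models\varphi(s_1,\dots,s_k)$ iff $(\alpha,<)\models\varphi^*(\bar X(s_1),\dots,\bar X(s_k))$. (b) Conversely, every MSO formula over $(\alpha,<)$ can be translated into a first-order $\mathcal L_{n,S}\cup\{\sim\}$-formula over $(\mathfrak T_{\alpha+1}^n,\sim)$: for every MSO formula $\psi(v_1,\dots,v_k,V_1,\dots,V_l)$ there is a first-order $\mathcal L_{n,S}\cup\{\sim\}$-formula $\psi^*(y_1,\dots,y_k,z_1,\dots,z_l)$ such that for all $\beta_1,\dots,\beta_k<\alpha$ and $A_1,\dots,A_l\subseteq\alpha$, $(\alpha,<)\models\psi(\beta_1,\dots,\beta_k,A_1,\dots,A_l)$ iff $(\mathfrak T_{\alpha+1}^n,\sim)\models\psi^*(c_{\{\beta_1\}},\dots,c_{\{\beta_k\}},c_{A_1},\dots,c_{A_l})$.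
   Context: $\mathcal L_{n,S}=\{\subseteq,S_0,\dots,S_{n-1}\}$. $\mathfrak T_\alpha^n=(n^{<\alpha},\subseteq,S_0,\dots,S_{n-1})$, where $n^{<\alpha}$ is the set of functions $s:\beta\to n=\{0,\dots,n-1\}$ with $\beta<\alpha$ (the height of $s$ is $\operatorname{ht}(s)=\beta$), $\subseteq$ is inclusion, and $S_i(s)$ is $s$ extended by one further entry $i$; when $\alpha$ is not a limit ordinal, $S_i$ is undefined on nodes of maximal height and is understood through its graph $E_i(x,y)\Leftrightarrow y=S_i(x)$, as a binary relation. $x\sim y$ means $\operatorname{ht}(x)=\operatorname{ht}(y)$. MSO (monadic second-order logic) over $(\alpha,<)$ has first-order variables ranging over elements of $\alpha$ and set variables ranging over subsets of $\alpha$. The code of a node $s:\beta\to n$ is the $n$-tuple $\bar X(s)=(X_0,\dots,X_{n-1})$ with $X_i=\{\gamma<\beta:s(\gamma)=i\}$. For $A\subseteq\alpha$, $c_A:\alpha\to n$ is the node of height $\alpha$ of $\mathfrak T_{\alpha+1}^n$ with $c_A(\gamma)=1$ if $\gamma\in A$ and $c_A(\gamma)=0$ otherwise. -}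

module Defs where

open import Level using (Level; Lift; suc)
open import Axiom.ExcludedMiddle using (ExcludedMiddle)
open import Data.Empty using (⊥)
open import Data.Fin.Base using (Fin; fromℕ<; remQuot)
open import Data.Nat.Base using (ℕ; _≤_; _*_; z≤n; s≤s)
open import Data.Nat.Properties using (≤-trans)
open import Data.Product.Base using (Σ; _,_; _×_; ∃; proj₁; uncurry)
open import Data.Sum.Base using (_⊎_)
open import Data.Vec.Functional using (Vector; _∷_)
open import Function.Base using (_∘_)
open import Function.Bundles using (_⇔_)
open import Induction.WellFounded using (WellFounded; Acc; acc)
open import Relation.Binary.Bundles using (Setoid)
open import Relation.Binary.Core using (Rel)
open import Relation.Binary.PropositionalEquality.Core
  using (_≡_; refl; sym; trans)
open import Relation.Binary.Structures using (IsStrictTotalOrder)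
open import Relation.Nullary.Construct.Add.Supremum using (_⁺; ⊤⁺; [_])
import Relation.Binary.Construct.Add.Supremum.Strict as Add
open import Relation.Nullary.Decidable.Core using (yes; no)
open import Relation.Nullary.Negation.Core using (¬_)
open import Relation.Unary using (Pred)

private
  variable
    ℓ : Level
    k l : ℕ

-- Ordinals are presented as well-orders: an element β of the carrier of α
-- stands for an ordinal β < α, whose own elements are the γ with γ < β.

record Ordinal ℓ : Set (suc ℓ) where
  infix 4 _<_
  field
    Carrier            : Set ℓ
    _<_                : Rel Carrier ℓ
    isStrictTotalOrder : IsStrictTotalOrder _≡_ _<_
    <-wellFounded      : WellFounded _<_

  open IsStrictTotalOrder isStrictTotalOrder public using (compare; _<?_)

  -- γ = β ∪ {β}
  IsSucc : Rel Carrier ℓ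
  IsSucc β γ = ∀ δ → (δ < γ) ⇔ (δ < β ⊎ δ ≡ β)

-- This counts 0 as a limit: on the empty tree every S_i is total.

IsLimit : Ordinal ℓ → Set ℓ
IsLimit α = ∀ β → ∃ λ γ → Ordinal.IsSucc α β γ

infix 8 _+1

-- The new top element ⊤⁺ of α +1 stands for α itself.

_+1 : Ordinal ℓ → Ordinal ℓ
α +1 = record
  { Carrier            = Ordinal.Carrier α ⁺
  ; _<_                = _<⁺_
  ; isStrictTotalOrder = <⁺-isStrictTotalOrder-≡ (Ordinal.isStrictTotalOrder α)
  ; <-wellFounded      = wf
  }
  where
  open Add (Ordinal._<_ α)

  acc⁺ : ∀ {β} → Acc (Ordinal._<_ α) β → Acc _<⁺_ [ β ]
  acc⁺ (acc rs) = acc λ { Add.[ γ<β ] → acc⁺ (rs γ<β) }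

  wf : WellFounded _<⁺_
  wf [ β ] = acc⁺ (Ordinal.<-wellFounded α β)
  wf ⊤⁺    = acc λ { Add.[ β ]<⊤⁺ → acc⁺ (Ordinal.<-wellFounded α β) }

-- Only unary function symbols and binary relation symbols are needed.

record Language : Set₁ where
  field
    Op   : Set
    Rel₂ : Set

open Language

data Term (L : Language) (k : ℕ) : Set where
  var : Fin k → Term L k
  op  : Op L → Term L k → Term L k

-- Formulas whose free variables are among k given ones; quantifiers bind
-- de Bruijn index zero.

infix  6 _≐_
infix  7 ¬′_
infixr 5 _∧_ _∨_
infixr 4 _⇒_

data Formula (L : Language) (k : ℕ) : Set where
  _≐_         : Term L k → Term L k → Formula L k
  rel         : Rel₂ L → Term L k → Term L k → Formula L k
  bot         : Formula L k
  ¬′_         : Formula L k → Formula L k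
  _∧_ _∨_ _⇒_ : Formula L k → Formula L k → Formula L k
  all′ ex′    : Formula L (ℕ.suc k) → Formula L k

-- The equality symbol denotes the equality of the domain setoid, which the
-- congruence fields make a genuine equality for the structure.

record Structure (L : Language) ℓ : Set (suc ℓ) where
  field
    domain : Setoid ℓ ℓ

  open Setoid domain public using (_≈_) renaming (Carrier to Dom)

  field
    ⟦_⟧ᵒ     : Op L → Dom → Dom
    ⟦_⟧ʳ     : Rel₂ L → Rel Dom ℓ
    op-cong  : ∀ f {x x′} → x ≈ x′ → ⟦ f ⟧ᵒ x ≈ ⟦ f ⟧ᵒ x′
    rel-resp : ∀ r {x x′ y y′} → x ≈ x′ → y ≈ y′ →
               ⟦ r ⟧ʳ x y → ⟦ r ⟧ʳ x′ y′

module _ {L : Language} (𝔐 : Structure L ℓ) where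
  open Structure 𝔐

  eval : Term L k → Vector Dom k → Dom
  eval (var i)  ρ = ρ i
  eval (op f t) ρ = ⟦ f ⟧ᵒ (eval t ρ)

  Sat : Formula L k → Vector Dom k → Set ℓ
  Sat (t ≐ u)     ρ = eval t ρ ≈ eval u ρ
  Sat (rel r t u) ρ = ⟦ r ⟧ʳ (eval t ρ) (eval u ρ)
  Sat bot         ρ = Lift ℓ ⊥
  Sat (¬′ φ)      ρ = ¬ Sat φ ρ
  Sat (φ ∧ ψ)     ρ = Sat φ ρ × Sat ψ ρ
  Sat (φ ∨ ψ)     ρ = Sat φ ρ ⊎ Sat ψ ρ
  Sat (φ ⇒ ψ)     ρ = Sat φ ρ → Sat ψ ρ
  Sat (all′ φ)    ρ = ∀ x → Sat φ (x ∷ ρ)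
  Sat (ex′ φ)     ρ = ∃ λ x → Sat φ (x ∷ ρ)

infix 3 _⊨_[_]

_⊨_[_] : {L : Language} (𝔐 : Structure L ℓ) →
         Formula L k → Vector (Structure.Dom 𝔐) k → Set ℓ
𝔐 ⊨ φ [ ρ ] = Sat 𝔐 φ ρ

-- k element variables and l set variables may occur free.

data MSO (k l : ℕ) : Set where
  _≐_ _≺_     : Fin k → Fin k → MSO k l
  _ϵ_         : Fin k → Fin l → MSO k l
  bot         : MSO k l
  ¬′_         : MSO k l → MSO k l
  _∧_ _∨_ _⇒_ : MSO k l → MSO k l → MSO k l
  all₁ ex₁    : MSO (ℕ.suc k) l → MSO k l
  all₂ ex₂    : MSO k (ℕ.suc l) → MSO k l

infix 6 _≺_ _ϵ_

module _ (α : Ordinal ℓ) where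
  open Ordinal α

  SatMSO : MSO k l → Vector Carrier k → Vector (Pred Carrier ℓ) l → Set (suc ℓ)
  SatMSO (i ≐ j)  ρ σ = Lift (suc ℓ) (ρ i ≡ ρ j)
  SatMSO (i ≺ j)  ρ σ = Lift (suc ℓ) (ρ i < ρ j)
  SatMSO (i ϵ m)  ρ σ = Lift (suc ℓ) (σ m (ρ i))
  SatMSO bot      ρ σ = Lift (suc ℓ) ⊥
  SatMSO (¬′ φ)   ρ σ = ¬ SatMSO φ ρ σ
  SatMSO (φ ∧ ψ)  ρ σ = SatMSO φ ρ σ × SatMSO ψ ρ σ
  SatMSO (φ ∨ ψ)  ρ σ = SatMSO φ ρ σ ⊎ SatMSO ψ ρ σ
  SatMSO (φ ⇒ ψ)  ρ σ = SatMSO φ ρ σ → SatMSO ψ ρ σ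
  SatMSO (all₁ φ) ρ σ = ∀ β → SatMSO φ (β ∷ ρ) σ
  SatMSO (ex₁ φ)  ρ σ = ∃ λ β → SatMSO φ (β ∷ ρ) σ
  SatMSO (all₂ φ) ρ σ = ∀ X → SatMSO φ ρ (X ∷ σ)
  SatMSO (ex₂ φ)  ρ σ = ∃ λ X → SatMSO φ ρ (X ∷ σ)

infix 3 _⊨ᴹ_[_⨾_]

_⊨ᴹ_[_⨾_] : (α : Ordinal ℓ) → MSO k l →
            Vector (Ordinal.Carrier α) k →
            Vector (Pred (Ordinal.Carrier α) ℓ) l → Set (suc ℓ)
α ⊨ᴹ φ [ ρ ⨾ σ ] = SatMSO α φ ρ σ

module _ (n : ℕ) (α : Ordinal ℓ) where
  open Ordinal α

  -- The irrelevant argument keeps an entry from depending on the chosen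
  -- proof of γ < height.

  record Node : Set ℓ where
    constructor node
    field
      height : Carrier
      entry  : ∀ γ → .(γ < height) → Fin n

module _ {n : ℕ} {α : Ordinal ℓ} where
  open Ordinal α
  open Node

  infix 4 _[_]=_ _⊆_ _≋_ _∼_

  -- (γ , i) belongs to the graph of s.

  _[_]=_ : Node n α → Carrier → Fin n → Set ℓ
  s [ γ ]= i = Σ (γ < height s) λ γ<s → entry s γ γ<s ≡ i

  code : Node n α → Vector (Pred Carrier ℓ) n
  code s i γ = s [ γ ]= i

  _⊆_ : Rel (Node n α) ℓ
  s ⊆ t = ∀ γ i → s [ γ ]= i → t [ γ ]= i

  -- Equality of nodes as functions; propositional equality would be finer
  -- in the absence of function extensionality.

  record _≋_ (s t : Node n α) : Set ℓ where
    constructor _,_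
    field
      height-≡ : height s ≡ height t
      entry-≡  : ∀ γ .p .q → entry s γ p ≡ entry t γ q

  _∼_ : Rel (Node n α) ℓ
  s ∼ t = height s ≡ height t

  -- E i s t is the graph of S_i: t = s ∪ {(ht(s) , i)}.

  E : Fin n → Rel (Node n α) ℓ
  E i s t = IsSucc (height s) (height t) × s ⊆ t × t [ height s ]= i

  entryOr : Fin n → Node n α → Carrier → Fin n
  entryOr i s γ with γ <? height s
  ... | yes γ<s = entry s γ γ<s
  ... | no  _   = i

  S : IsLimit α → Fin n → Node n α → Node n α
  S lim i s = node (proj₁ (lim (height s))) λ γ _ → entryOr i s γ

  ≋-refl : ∀ {s} → s ≋ s
  ≋-refl = refl , λ _ _ _ → refl

  ≋-sym : ∀ {s t} → s ≋ t → t ≋ s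
  ≋-sym (h , e) = sym h , λ γ p q → sym (e γ q p)

  ≋-trans : ∀ {s t u} → s ≋ t → t ≋ u → s ≋ u
  ≋-trans (refl , e) (refl , f) = refl , λ γ p q → trans (e γ p p) (f γ p q)

  ≋⇒⊆ : ∀ {s t} → s ≋ t → s ⊆ t
  ≋⇒⊆ (refl , e) γ i (p , eq) = p , trans (sym (e γ p p)) eq

  ⊆-trans : ∀ {s t u} → s ⊆ t → t ⊆ u → s ⊆ u
  ⊆-trans s⊆t t⊆u γ i = t⊆u γ i ∘ s⊆t γ i

  ⊆-resp : ∀ {s s′ t t′} → s ≋ s′ → t ≋ t′ → s ⊆ t → s′ ⊆ t′
  ⊆-resp s≋s′ t≋t′ s⊆t =
    ⊆-trans (≋⇒⊆ (≋-sym s≋s′)) (⊆-trans s⊆t (≋⇒⊆ t≋t′))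

  ∼-resp : ∀ {s s′ t t′} → s ≋ s′ → t ≋ t′ → s ∼ t → s′ ∼ t′
  ∼-resp (h , _) (h′ , _) eq = trans (sym h) (trans eq h′)

  E-resp : ∀ i {s s′ t t′} → s ≋ s′ → t ≋ t′ → E i s t → E i s′ t′
  E-resp i s≋s′@(refl , _) t≋t′@(refl , _) (succ , s⊆t , last) =
    succ , ⊆-resp s≋s′ t≋t′ s⊆t , ≋⇒⊆ t≋t′ _ _ last

  S-cong : ∀ lim i {s t} → s ≋ t → S lim i s ≋ S lim i t
  S-cong lim i {s} {t} (refl , e) = refl , λ γ _ _ → agree γ
    where
    agree : ∀ γ → entryOr i s γ ≡ entryOr i t γ
    agree γ with γ <? height s
    ... | yes p = e γ p p
    ... | no  _ = refl

nodes : (n : ℕ) (α : Ordinal ℓ) → Setoid ℓ ℓ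
nodes n α = record
  { Carrier       = Node n α
  ; _≈_           = _≋_
  ; isEquivalence = record { refl = ≋-refl ; sym = ≋-sym ; trans = ≋-trans }
  }

-- ℒ has S_i as function symbols; ℒᴱ has their graphs instead, as required
-- when α is not a limit; ℒ∼ adds ∼ to the latter.

data Incl : Set where
  incl : Incl

data InclE (n : ℕ) : Set where
  incl : InclE n
  edge : Fin n → InclE n

data InclE∼ (n : ℕ) : Set where
  incl : InclE∼ n
  edge : Fin n → InclE∼ n
  sim  : InclE∼ n

ℒ ℒᴱ ℒ∼ : ℕ → Language
ℒ  n = record { Op = Fin n ; Rel₂ = Incl }
ℒᴱ n = record { Op = ⊥ ; Rel₂ = InclE n }
ℒ∼ n = record { Op = ⊥ ; Rel₂ = InclE∼ n }

𝔗 : (n : ℕ) (α : Ordinal ℓ) → IsLimit α → Structure (ℒ n) ℓ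
𝔗 n α lim = record
  { domain   = nodes n α
  ; ⟦_⟧ᵒ     = S lim
  ; ⟦_⟧ʳ     = λ { incl → _⊆_ }
  ; op-cong  = S-cong lim
  ; rel-resp = λ { incl → ⊆-resp }
  }

𝔗ᴱ : (n : ℕ) (α : Ordinal ℓ) → Structure (ℒᴱ n) ℓ
𝔗ᴱ n α = record
  { domain   = nodes n α
  ; ⟦_⟧ᵒ     = λ ()
  ; ⟦_⟧ʳ     = λ { incl → _⊆_ ; (edge i) → E i }
  ; op-cong  = λ ()
  ; rel-resp = λ { incl → ⊆-resp ; (edge i) → E-resp i }
  }

𝔗∼ : (n : ℕ) (α : Ordinal ℓ) → Structure (ℒ∼ n) ℓ
𝔗∼ n α = record
  { domain   = nodes n α
  ; ⟦_⟧ᵒ     = λ ()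
  ; ⟦_⟧ʳ     = λ { incl → _⊆_ ; (edge i) → E i ; sim → _∼_ }
  ; op-cong  = λ ()
  ; rel-resp = λ { incl → ⊆-resp ; (edge i) → E-resp i ; sim → ∼-resp }
  }

-- Index j * n + i holds the set X_i of the code of s_j.

codes : {n : ℕ} {α : Ordinal ℓ} →
        Vector (Node n α) k → Vector (Pred (Ordinal.Carrier α) ℓ) (k * n)
codes {n = n} s m = uncurry (λ j i → code (s j) i) (remQuot n m)

-- c_A, with 0 and 1 taken in Fin n; deciding membership in an arbitrary
-- subset is what needs excluded middle.

c : ExcludedMiddle ℓ → {n : ℕ} → 2 ≤ n → {α : Ordinal ℓ} →
    Pred (Ordinal.Carrier α) ℓ → Node n (α +1)
c em {n} 2≤n {α} A = node ⊤⁺ value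
  where
  value : ∀ γ → .(Ordinal._<_ (α +1) γ ⊤⁺) → Fin n
  value ⊤⁺    ()
  value [ γ ] _ with em {A γ}
  ... | yes _ = fromℕ< 2≤n
  ... | no  _ = fromℕ< (≤-trans (s≤s z≤n) 2≤n)

{-# OPTIONS --safe #-}
-- Trees to MSO: a node is its code, so a quantifier over nodes becomes n set
-- quantifiers restricted to codes, i.e. to tuples of pairwise disjoint sets whose
-- union is an initial segment {γ : γ < β}; the height of a node is the β bounding
-- its code.  Iterated function symbols S_i are first replaced by their graphs.
--
-- MSO to trees: every node z, of whatever height, is taken to represent the set of
-- γ with z(γ) = 1, so set quantifiers need no restriction, and an element is
-- represented by any node with exactly one entry 1.  A node u serves as a name of
-- its height, since "y(ht(u)) = 1" is definable: some w ∼ u has S_1(w) ⊆ y.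

module Submission where

open import Defs
open import Axiom.ExcludedMiddle using (ExcludedMiddle)
open import Data.Fin.Base using (Fin; zero; suc; fromℕ<; combine; _↑ˡ_; _↑ʳ_)
open import Data.Fin.Properties using (_≟_; remQuot-combine)
open import Data.Nat.Base using (ℕ; _≤_; _+_; _*_; s≤s; z≤n)
open import Data.Nat.Properties using (≤-trans)
open import Data.Product.Base using (_×_; _,_; ∃; proj₁; proj₂)
open import Data.Product.Function.NonDependent.Propositional using (_×-⇔_)
open import Data.Sum.Base using (inj₁; inj₂; [_,_]′)
open import Data.Sum.Function.Propositional using (_⊎-⇔_)
open import Data.Vec.Functional using (Vector; []; _∷_; _++_; head; tail)
open import Data.Vec.Functional.Properties using (lookup-++ˡ; lookup-++ʳ)
open import Function.Base using (_∘_)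
open import Function.Bundles using (_⇔_; mk⇔; Equivalence)
open import Function.Construct.Composition using (_⇔-∘_)
open import Function.Construct.Identity using (⇔-id)
open import Function.Construct.Symmetry using (⇔-sym)
open import Function.Related.TypeIsomorphisms using (→-cong-⇔; ¬-cong-⇔)
open import Induction.WellFounded using (Acc; acc)
open import Level using (Level; Lift; lift; lower)
open import Relation.Binary.Construct.Add.Supremum.Strict using ([_]; [_]<⊤⁺)
open import Relation.Binary.Definitions using (tri<; tri≈; tri>)
open import Relation.Binary.PropositionalEquality.Core
  using (_≡_; refl; sym; trans; cong; subst; subst₂)
open import Relation.Binary.Structures using (IsStrictTotalOrder)
open import Relation.Nullary.Construct.Add.Supremum using (⊤⁺; [_]; []-injective)
open import Relation.Nullary.Decidable.Core using (Dec; yes; no; recompute)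
open import Relation.Nullary.Negation.Core using (¬_; contradiction)
open import Relation.Unary using (Pred; ｛_｝)

open Equivalence using (to; from)
open Node

private
  variable
    ℓ a b p q r g : Level
    k l m n : ℕ
    A : Set a
    B : Set b
    P : A → Set p
    Q : B → Set q
    G : B → Set g

-- Equivalences of formulas and transfer of quantifiers.

lift⇔ : Lift ℓ A ⇔ A
lift⇔ = mk⇔ lower lift

×⇔⇔ : ((A → B) × (B → A)) ⇔ (A ⇔ B)
×⇔⇔ = mk⇔ (λ (f , g) → mk⇔ f g) (λ e → to e , from e)

∀-cong : {P : A → Set p} {Q : A → Set q} →
         (∀ x → P x ⇔ Q x) → (∀ x → P x) ⇔ (∀ x → Q x)
∀-cong e = mk⇔ (λ f x → to (e x) (f x)) (λ f x → from (e x) (f x))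

∃-cong : {P : A → Set p} {Q : A → Set q} →
         (∀ x → P x ⇔ Q x) → ∃ P ⇔ ∃ Q
∃-cong e = mk⇔ (λ (x , p) → x , to (e x) p) (λ (x , q) → x , from (e x) q)

module _ (R : A → B → Set r)
         (left-total : ∀ a → ∃ λ b → R a b) (right-total : ∀ b → ∃ λ a → R a b)
         (P⇔Q : ∀ {a b} → R a b → P a ⇔ Q b) where

  -- Many nodes can represent one set, so quantifiers are compared along a relation rather than a
  -- map; each instance is answered by a related one on the other side.
  ∀-transfer : (∀ a → P a) ⇔ (∀ b → Q b)
  ∀-transfer = mk⇔
    (λ f b → let a , r = right-total b in to (P⇔Q r) (f a))
    (λ f a → let b , r = left-total a in from (P⇔Q r) (f b))

  ∃-transfer : ∃ P ⇔ ∃ Q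
  ∃-transfer = mk⇔
    (λ (a , p) → let b , r = left-total a in b , to (P⇔Q r) p)
    (λ (b , q) → let a , r = right-total b in a , from (P⇔Q r) q)

module _ (R : A → B → Set r)
         (left-total : ∀ a → ∃ λ b → G b × R a b)
         (right-total : ∀ b → G b → ∃ λ a → R a b)
         (P⇔Q : ∀ {a b} → R a b → P a ⇔ Q b) where

  -- The guard `G` singles out the objects that stand for some `a`: codes among tuples of sets,
  -- singletons among nodes.
  ∀-transfer-guarded : (∀ a → P a) ⇔ (∀ b → G b → Q b)
  ∀-transfer-guarded = mk⇔
    (λ f b g → let a , r = right-total b g in to (P⇔Q r) (f a))
    (λ f a → let b , g , r = left-total a in from (P⇔Q r) (f b g))

  ∃-transfer-guarded : ∃ P ⇔ ∃ λ b → G b × Q b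
  ∃-transfer-guarded = mk⇔
    (λ (a , p) → let b , g , r = left-total a in b , g , to (P⇔Q r) p)
    (λ (b , g , q) → let a , r = right-total b g in a , from (P⇔Q r) q)

-- Well-orders: extensionality and successors.

module _ (α : Ordinal ℓ) where
  open Ordinal α
  open IsStrictTotalOrder isStrictTotalOrder
    using () renaming (irrefl to <-irrefl; trans to <-trans)

  -- Were one of the two smaller, it would be a predecessor of the larger and hence, by hypothesis,
  -- of itself.
  <-extensional : ∀ {β δ} → (∀ γ → (γ < β) ⇔ (γ < δ)) → β ≡ δ
  <-extensional {β} {δ} e with compare β δ
  ... | tri< β<δ _ _ = contradiction (from (e β) β<δ) (<-irrefl refl)
  ... | tri≈ _ β≡δ _ = β≡δ
  ... | tri> _ _ δ<β = contradiction (to (e δ) δ<β) (<-irrefl refl)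

  IsSucc⇒< : ∀ {β γ} → IsSucc β γ → β < γ
  IsSucc⇒< β⁺γ = from (β⁺γ _) (inj₂ refl)

  IsSucc⇒least : ∀ {β γ δ} → IsSucc β γ → β < δ → ∀ ε → ε < γ → ε < δ
  IsSucc⇒least β⁺γ β<δ ε ε<γ =
    [ (λ ε<β → <-trans ε<β β<δ) , (λ { refl → β<δ }) ]′ (to (β⁺γ ε) ε<γ)

  -- Descend from `γ` through elements still above `β`; well-foundedness stops the descent at one
  -- with nothing in between, which is the successor.
  <⇒∃IsSucc : ExcludedMiddle ℓ → ∀ {β γ} → β < γ → ∃ λ δ → IsSucc β δ
  <⇒∃IsSucc em {β} {γ} = go (<-wellFounded γ)
    where
    go : ∀ {γ} → Acc _<_ γ → β < γ → ∃ λ δ → IsSucc β δ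
    go {γ} (acc rs) β<γ with em {∃ λ ε → β < ε × ε < γ}
    ... | yes (ε , β<ε , ε<γ) = go (rs ε<γ) β<ε
    ... | no  β⋖γ = γ , λ δ → mk⇔ (below δ)
                      [ (λ δ<β → <-trans δ<β β<γ) , (λ { refl → β<γ }) ]′
      where
      below : ∀ δ → δ < γ → _
      below δ δ<γ with compare δ β
      ... | tri< δ<β _ _ = inj₁ δ<β
      ... | tri≈ _ δ≡β _ = inj₂ δ≡β
      ... | tri> _ _ β<δ = contradiction (δ , β<δ , δ<γ) β⋖γ

-- Nodes: antisymmetry, restriction, edges.

module _ {n : ℕ} {α : Ordinal ℓ} where
  open Ordinal α
  open IsStrictTotalOrder isStrictTotalOrder
    using () renaming (irrefl to <-irrefl; trans to <-trans)

  ⊆⇒height : ∀ {s t : Node n α} → s ⊆ t → ∀ γ → γ < height s → γ < height t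
  ⊆⇒height s⊆t γ γ<s = proj₁ (s⊆t γ _ (γ<s , refl))

  []=-functional : ∀ (s : Node n α) {γ i j} → s [ γ ]= i → s [ γ ]= j → i ≡ j
  []=-functional s (_ , refl) (_ , refl) = refl

  ⊆-antisym : ∀ {s t : Node n α} → s ⊆ t → t ⊆ s → s ≋ t
  ⊆-antisym {s} {t} s⊆t t⊆s =
    <-extensional α (λ γ → mk⇔ (⊆⇒height s⊆t γ) (⊆⇒height t⊆s γ)) ,
    -- The bound `p` is irrelevant while `_⊆_` asks for a relevant one; decidability of `<` supplies
    -- it.
    λ γ p q → let p′ = recompute (γ <? height s) p in
      []=-functional t (s⊆t γ _ (p′ , refl)) (⊆⇒height s⊆t γ p′ , refl)

  truncate : (t : Node n α) (δ : Carrier) → (∀ γ → γ < δ → γ < height t) → Node n α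
  truncate t δ δ≤t = node δ λ γ γ<δ → entry t γ (δ≤t γ γ<δ)

  truncate-⊆ : ∀ t δ δ≤t → truncate t δ δ≤t ⊆ t
  truncate-⊆ t δ δ≤t γ i (γ<δ , eq) = δ≤t γ γ<δ , eq

  module _ (em : ExcludedMiddle ℓ) where

    -- The restrictions of `t` to `γ` and to the successor of `γ` form the edge; the second still
    -- fits inside `t` because `γ < height t`.
    []=⇒E : ∀ t {γ i} → t [ γ ]= i →
            ∃ λ u → ∃ λ v → height u ≡ γ × E i u v × v ⊆ t
    []=⇒E t {γ} {i} (γ<t , eq) =
      truncate t γ γ≤t , truncate t δ δ≤t , refl ,
      (γ⁺δ , (λ ε j (ε<γ , eq′) → from (γ⁺δ ε) (inj₁ ε<γ) , eq′) ,
        IsSucc⇒< α γ⁺δ , eq) ,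
      truncate-⊆ t δ δ≤t
      where
      succ = <⇒∃IsSucc α em γ<t
      δ    = proj₁ succ
      γ⁺δ  = proj₂ succ
      γ≤t : ∀ ε → ε < γ → ε < height t
      γ≤t ε ε<γ = <-trans ε<γ γ<t
      δ≤t : ∀ ε → ε < δ → ε < height t
      δ≤t = IsSucc⇒least α γ⁺δ γ<t

  module _ (lim : IsLimit α) (i : Fin n) (s : Node n α) where
    private
      s⁺s′ = proj₂ (lim (height s))

    E-S : E i s (S lim i s)
    E-S = s⁺s′ , below , IsSucc⇒< α s⁺s′ , last
      where
      below : s ⊆ S lim i s
      below γ j (γ<s , eq) = from (s⁺s′ γ) (inj₁ γ<s) , value
        where
        value : entryOr i s γ ≡ j
        value with γ <? height s
        ... | yes _   = eq
        ... | no γ≮s = contradiction γ<s γ≮s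
      -- The default of `entryOr` is what supplies the new last entry.
      last : entryOr i s (height s) ≡ i
      last with height s <? height s
      ... | yes s<s = contradiction s<s (<-irrefl refl)
      ... | no  _   = refl

  -- A position below `height t` is either below `height s`, where both extensions copy `s`, or
  -- equal to it, where both have entry `i`.
  E-unique : ∀ i {s t u : Node n α} → E i s t → E i s u → t ≋ u
  E-unique i {s} {t} {u} e f = ⊆-antisym (half e f) (half f e)
    where
    half : ∀ {t u} → E i s t → E i s u → t ⊆ u
    half {t} {u} (s⁺t , s⊆t , t[s]) (_ , s⊆u , u[s]) γ j t[γ]@(γ<t , _)
      with to (s⁺t γ) γ<t
    ... | inj₁ γ<s =
      subst (u [ γ ]=_) ([]=-functional t (s⊆t γ _ (γ<s , refl)) t[γ]) (s⊆u γ _ (γ<s , refl))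
    ... | inj₂ refl = subst (u [ γ ]=_) ([]=-functional t t[s] t[γ]) u[s]

  E⇔S : ∀ lim i {s t : Node n α} → E i s t ⇔ (t ≋ S lim i s)
  E⇔S lim i {s} = mk⇔
    (λ e → E-unique i e (E-S lim i s))
    (λ t≋S → E-resp i ≋-refl (≋-sym t≋S) (E-S lim i s))

-- From function symbols to their graphs

-- `e` places the variables of the term among those of the formula and `z` names its value; each
-- function symbol costs one quantifier, for its argument.
graph : Term (ℒ n) k → (Fin k → Fin m) → Fin m → Formula (ℒᴱ n) m
graph (var j)  e z = var z ≐ var (e j)
graph (op i t) e z =
  ex′ (graph t (suc ∘ e) zero ∧ rel (edge i) (var zero) (var (suc z)))

unnest : Formula (ℒ n) k → Formula (ℒᴱ n) k
unnest (t ≐ u) =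
  ex′ (ex′ (graph t (suc ∘ suc) (suc zero) ∧ graph u (suc ∘ suc) zero ∧
            var (suc zero) ≐ var zero))
unnest (rel incl t u) =
  ex′ (ex′ (graph t (suc ∘ suc) (suc zero) ∧ graph u (suc ∘ suc) zero ∧
            rel incl (var (suc zero)) (var zero)))
unnest bot      = bot
unnest (¬′ φ)   = ¬′ unnest φ
unnest (φ ∧ ψ)  = unnest φ ∧ unnest ψ
unnest (φ ∨ ψ)  = unnest φ ∨ unnest ψ
unnest (φ ⇒ ψ)  = unnest φ ⇒ unnest ψ
unnest (all′ φ) = all′ (unnest φ)
unnest (ex′ φ)  = ex′ (unnest φ)

module _ {n : ℕ} {α : Ordinal ℓ} (lim : IsLimit α) where

  graph-correct : (t : Term (ℒ n) k) (e : Fin k → Fin m) (z : Fin m)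
                  (ρ : Vector (Node n α) m) →
    (𝔗ᴱ n α ⊨ graph t e z [ ρ ]) ⇔ (ρ z ≋ eval (𝔗 n α lim) t (ρ ∘ e))
  graph-correct (var j)  e z ρ = ⇔-id _
  graph-correct (op i t) e z ρ = mk⇔
    (λ (w , w≋t , wEz) →
      ≋-trans (to (E⇔S lim i) wEz) (S-cong lim i (to (graph-correct t _ _ _) w≋t)))
    -- The witness is the value of `t` itself.
    (λ z≋St → _ , from (graph-correct t _ _ _) ≋-refl , from (E⇔S lim i) z≋St)

  unnest-correct : (φ : Formula (ℒ n) k) (ρ : Vector (Node n α) k) →
    (𝔗 n α lim ⊨ φ [ ρ ]) ⇔ (𝔗ᴱ n α ⊨ unnest φ [ ρ ])
  unnest-correct (t ≐ u) ρ = mk⇔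
    (λ t≋u → _ , _ , from (graph-correct t _ _ _) ≋-refl ,
             from (graph-correct u _ _ _) ≋-refl , t≋u)
    (λ (x , y , x≋t , y≋u , x≋y) →
      ≋-trans (≋-sym (to (graph-correct t _ _ _) x≋t))
        (≋-trans x≋y (to (graph-correct u _ _ _) y≋u)))
  unnest-correct (rel incl t u) ρ = mk⇔
    (λ t⊆u → _ , _ , from (graph-correct t _ _ _) ≋-refl ,
             from (graph-correct u _ _ _) ≋-refl , t⊆u)
    (λ (x , y , x≋t , y≋u , x⊆y) →
      ⊆-resp (to (graph-correct t _ _ _) x≋t) (to (graph-correct u _ _ _) y≋u) x⊆y)
  unnest-correct bot      ρ = ⇔-id _
  unnest-correct (¬′ φ)   ρ = ¬-cong-⇔ (unnest-correct φ ρ)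
  unnest-correct (φ ∧ ψ)  ρ = unnest-correct φ ρ ×-⇔ unnest-correct ψ ρ
  unnest-correct (φ ∨ ψ)  ρ = unnest-correct φ ρ ⊎-⇔ unnest-correct ψ ρ
  unnest-correct (φ ⇒ ψ)  ρ = →-cong-⇔ (unnest-correct φ ρ) (unnest-correct ψ ρ)
  unnest-correct (all′ φ) ρ = ∀-cong λ x → unnest-correct φ (x ∷ ρ)
  unnest-correct (ex′ φ)  ρ = ∃-cong λ x → unnest-correct φ (x ∷ ρ)

-- From trees to MSO

⋁ ⋀ : Vector (MSO k l) n → MSO k l
⋁ {n = ℕ.zero}  φ = bot
⋁ {n = ℕ.suc n} φ = head φ ∨ ⋁ (tail φ)
⋀ {n = ℕ.zero}  φ = ¬′ bot
⋀ {n = ℕ.suc n} φ = head φ ∧ ⋀ (tail φ)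

iff : MSO k l → MSO k l → MSO k l
iff φ ψ = (φ ⇒ ψ) ∧ (ψ ⇒ φ)

-- Tuple indices are known when a formula is built, so their equality becomes a truth constant.
decided : Dec A → MSO k l
decided (yes _) = ¬′ bot
decided (no _)  = bot

alls exs : ∀ n → MSO k (n + l) → MSO k l
alls ℕ.zero    φ = φ
alls (ℕ.suc n) φ = alls n (all₂ φ)
exs  ℕ.zero    φ = φ
exs  (ℕ.suc n) φ = exs n (ex₂ φ)

-- Unlike _++_ of the standard library, this satisfies
-- prepend (Y ∷ X) σ = Y ∷ prepend X σ definitionally.
prepend : Vector A n → Vector A l → Vector A (n + l)
prepend {n = ℕ.zero}  X σ = σ
prepend {n = ℕ.suc n} X σ = head X ∷ prepend (tail X) σ

prepend-↑ˡ : (X : Vector A n) (σ : Vector A l) (i : Fin n) → prepend X σ (i ↑ˡ l) ≡ X i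
prepend-↑ˡ X σ zero    = refl
prepend-↑ˡ X σ (suc i) = prepend-↑ˡ (tail X) σ i

prepend-↑ʳ : (X : Vector A n) (σ : Vector A l) (i : Fin l) → prepend X σ (n ↑ʳ i) ≡ σ i
prepend-↑ʳ {n = ℕ.zero}  X σ i = refl
prepend-↑ʳ {n = ℕ.suc n} X σ i = prepend-↑ʳ (tail X) σ i

-- The union of a code is the domain of its node, that is, the initial segment below its height.
isHeight : Fin k → (Fin n → Fin l) → MSO k l
isHeight β X = all₁ (iff (zero ≺ suc β) (⋁ λ i → zero ϵ X i))

isCode : (Fin n → Fin l) → MSO k l
isCode X = ex₁ (isHeight zero X) ∧
  all₁ (⋀ λ i → ⋀ λ j → zero ϵ X i ∧ zero ϵ X j ⇒ decided (i ≟ j))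

isSucc : Fin k → Fin k → MSO k l
isSucc β γ = all₁ (iff (zero ≺ suc γ) (zero ≺ suc β ∨ zero ≐ suc β))

included : (X Y : Fin n → Fin l) → MSO k l
included X Y = all₁ (⋀ λ i → zero ϵ X i ⇒ zero ϵ Y i)

isEdge : Fin n → (X Y : Fin n → Fin l) → MSO k l
isEdge i X Y =
  ex₁ (isHeight zero X ∧ ex₁ (isHeight zero Y ∧ isSucc (suc zero) zero ∧
    included X Y ∧ suc zero ϵ Y i))

-- A quantified node brings `n` set variables in front, which hold its code; the older ones move up
-- by `n`.
bind : (Fin k → Fin n → Fin l) → Fin (ℕ.suc k) → Fin n → Fin (n + l)
bind {n = n} {l = l} e = (λ i → i ↑ˡ l) ∷ (λ j i → n ↑ʳ e j i)

-- `e j i` is the set variable for the `i`-th set of the code of node `j`. Equality becomes mutual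
-- inclusion since `_⊆_` is antisymmetric up to `_≋_`.
toMSO : Formula (ℒᴱ n) k → (Fin k → Fin n → Fin l) → MSO 0 l
toMSO (var i ≐ var j)            e = included (e i) (e j) ∧ included (e j) (e i)
toMSO (rel incl (var i) (var j)) e = included (e i) (e j)
toMSO (rel (edge f) (var i) (var j)) e = isEdge f (e i) (e j)
toMSO bot      e = bot
toMSO (¬′ φ)   e = ¬′ toMSO φ e
toMSO (φ ∧ ψ)  e = toMSO φ e ∧ toMSO ψ e
toMSO (φ ∨ ψ)  e = toMSO φ e ∨ toMSO ψ e
toMSO (φ ⇒ ψ)  e = toMSO φ e ⇒ toMSO ψ e
toMSO {n = n} (all′ φ) e = alls n (isCode (bind e zero) ⇒ toMSO φ (bind e))
toMSO {n = n} (ex′ φ)  e = exs n (isCode (bind e zero) ∧ toMSO φ (bind e))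

-- Correctness of the translation of tree formulas.

module _ (α : Ordinal ℓ) where
  open Ordinal α

  private
    Subset = Pred Carrier ℓ

    variable
      ρ : Vector Carrier k
      σ : Vector Subset l

  ⋁-correct : (φ : Vector (MSO k l) n) →
              (α ⊨ᴹ ⋁ φ [ ρ ⨾ σ ]) ⇔ ∃ λ i → α ⊨ᴹ φ i [ ρ ⨾ σ ]
  ⋁-correct {n = ℕ.zero}  φ = mk⇔ (λ ()) (λ ())
  ⋁-correct {n = ℕ.suc n} φ = mk⇔
    [ (zero ,_) , (λ s → let i , p = to (⋁-correct (tail φ)) s in suc i , p) ]′
    (λ { (zero , p) → inj₁ p ; (suc i , p) → inj₂ (from (⋁-correct (tail φ)) (i , p)) })

  ⋀-correct : (φ : Vector (MSO k l) n) →
              (α ⊨ᴹ ⋀ φ [ ρ ⨾ σ ]) ⇔ (∀ i → α ⊨ᴹ φ i [ ρ ⨾ σ ])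
  ⋀-correct {n = ℕ.zero}  φ = mk⇔ (λ _ ()) (λ _ ())
  ⋀-correct {n = ℕ.suc n} φ = mk⇔
    (λ { (p , ps) zero → p ; (p , ps) (suc i) → to (⋀-correct (tail φ)) ps i })
    (λ f → f zero , from (⋀-correct (tail φ)) (f ∘ suc))

  decided-correct : (a? : Dec A) → (α ⊨ᴹ decided a? [ ρ ⨾ σ ]) ⇔ A
  decided-correct (yes a) = mk⇔ (λ _ → a) (λ _ ())
  decided-correct (no ¬a) = mk⇔ (λ ()) (λ a → lift (¬a a))

  alls-correct : ∀ n (φ : MSO k (n + l)) →
    (α ⊨ᴹ alls n φ [ ρ ⨾ σ ]) ⇔ (∀ (X : Vector Subset n) → α ⊨ᴹ φ [ ρ ⨾ prepend X σ ])
  alls-correct ℕ.zero    φ = mk⇔ (λ p _ → p) (λ f → f [])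
  alls-correct (ℕ.suc n) φ =
    mk⇔ (λ f X → f (tail X) (head X)) (λ f X Y → f (Y ∷ X)) ⇔-∘ alls-correct n (all₂ φ)

  exs-correct : ∀ n (φ : MSO k (n + l)) →
    (α ⊨ᴹ exs n φ [ ρ ⨾ σ ]) ⇔ ∃ λ (X : Vector Subset n) → α ⊨ᴹ φ [ ρ ⨾ prepend X σ ]
  exs-correct ℕ.zero    φ = mk⇔ (λ p → [] , p) proj₂
  exs-correct (ℕ.suc n) φ =
    mk⇔ (λ (X , Y , p) → Y ∷ X , p) (λ (X , p) → tail X , head X , p) ⇔-∘ exs-correct n (ex₂ φ)

  infix 4 _Encodes_

  -- Pointwise equivalence rather than equality with `code s`: a quantified tuple need only have the
  -- same elements.
  _Encodes_ : Vector Subset n → Node n α → Set ℓ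
  X Encodes s = ∀ i γ → X i γ ⇔ (s [ γ ]= i)

  isHeight-correct : ∀ (β : Fin k) (e : Fin n → Fin l) →
    (α ⊨ᴹ isHeight β e [ ρ ⨾ σ ]) ⇔ (∀ γ → (γ < ρ β) ⇔ ∃ λ i → σ (e i) γ)
  isHeight-correct β e = ∀-cong λ γ →
    ×⇔⇔ ⇔-∘ (→-cong-⇔ lift⇔ below ×-⇔ →-cong-⇔ below lift⇔)
    where
    below : ∀ {γ} → (α ⊨ᴹ ⋁ (λ i → zero ϵ e i) [ γ ∷ _ ⨾ _ ]) ⇔ _
    below = ∃-cong (λ i → lift⇔) ⇔-∘ ⋁-correct _

  Encodes⇒isHeight : ∀ (β : Fin k) {e : Fin n → Fin l} {s} → σ ∘ e Encodes s →
    (α ⊨ᴹ isHeight β e [ ρ ⨾ σ ]) ⇔ (ρ β ≡ height s)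
  Encodes⇒isHeight β {e} {s} X = mk⇔
    (λ h → <-extensional α λ γ → ⇔-sym (dom γ) ⇔-∘ h γ)
    (λ { refl → dom }) ⇔-∘ isHeight-correct β e
    where
    dom : ∀ γ → (γ < height s) ⇔ ∃ λ i → _
    dom γ = mk⇔ (λ γ<s → _ , from (X _ γ) (γ<s , refl)) (λ (i , x) → proj₁ (to (X i γ) x))

  isCode-correct : (e : Fin n → Fin l) →
    (α ⊨ᴹ isCode e [ ρ ⨾ σ ]) ⇔ ∃ λ s → σ ∘ e Encodes s
  isCode-correct {σ = σ} e = mk⇔
    (λ ((β , h) , u) → decode β (to (isHeight-correct zero e) h)
      (λ γ i j x y → to (decided-correct (i ≟ j))
        (to (⋀-correct _) (to (⋀-correct _) (u γ) i) j (lift x , lift y))))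
    (λ (s , X) → (height s , from (Encodes⇒isHeight zero X) refl) ,
      λ γ → from (⋀-correct _) λ i → from (⋀-correct _) λ j (lift x , lift y) →
        from (decided-correct (i ≟ j)) ([]=-functional s (to (X i γ) x) (to (X j γ) y)))
    where
    -- The entry at `γ` is an index whose set contains `γ`: the union condition provides one,
    -- disjointness makes it the only one.
    decode : ∀ β → (∀ γ → (γ < β) ⇔ ∃ λ i → σ (e i) γ) →
             (∀ γ i j → σ (e i) γ → σ (e j) γ → i ≡ j) → ∃ λ s → σ ∘ e Encodes s
    decode β h u = node β (λ γ γ<β → proj₁ (value γ γ<β)) , λ i γ → mk⇔
      (λ x → let γ<β = from (h γ) (i , x) in γ<β , u γ _ _ (proj₂ (value γ γ<β)) x)
      (λ { (γ<β , refl) → proj₂ (value γ γ<β) })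
      where
      -- An entry takes its bound irrelevantly, whence `recompute`.
      value : ∀ γ → .(γ < β) → ∃ λ i → σ (e i) γ
      value γ γ<β = to (h γ) (recompute (γ <? β) γ<β)

  isSucc-correct : (β γ : Fin k) → (α ⊨ᴹ isSucc β γ [ ρ ⨾ σ ]) ⇔ IsSucc (ρ β) (ρ γ)
  isSucc-correct β γ = ∀-cong λ δ →
    ×⇔⇔ ⇔-∘ (→-cong-⇔ lift⇔ (lift⇔ ⊎-⇔ lift⇔) ×-⇔ →-cong-⇔ (lift⇔ ⊎-⇔ lift⇔) lift⇔)

  included-correct : ∀ {e f : Fin n → Fin l} {s t} → σ ∘ e Encodes s → σ ∘ f Encodes t →
    (α ⊨ᴹ included e f [ ρ ⨾ σ ]) ⇔ (s ⊆ t)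
  included-correct X Y = ∀-cong λ γ →
    ∀-cong (λ i → →-cong-⇔ (X i γ ⇔-∘ lift⇔) (Y i γ ⇔-∘ lift⇔)) ⇔-∘ ⋀-correct _

  isEdge-correct : ∀ i {e f : Fin n → Fin l} {s t} → σ ∘ e Encodes s → σ ∘ f Encodes t →
    (α ⊨ᴹ isEdge i e f [ ρ ⨾ σ ]) ⇔ E i s t
  isEdge-correct {σ = σ} {ρ = ρ} i {s = s} {t} X Y = mk⇔
    (λ (β , hβ , γ , hγ , β⁺γ , s⊆t , t[β]) →
      let β≡s = to (Encodes⇒isHeight zero X) hβ
          γ≡t = to (Encodes⇒isHeight zero Y) hγ
      in subst₂ IsSucc β≡s γ≡t
           (to (isSucc-correct {ρ = γ ∷ β ∷ ρ} {σ = σ} (suc zero) zero) β⁺γ) ,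
         to (included-correct X Y) s⊆t ,
         subst (t [_]= i) β≡s (to (Y i β) (lower t[β])))
    (λ (s⁺t , s⊆t , t[s]) →
      height s , from (Encodes⇒isHeight zero X) refl ,
      height t , from (Encodes⇒isHeight zero Y) refl ,
      from (isSucc-correct {ρ = height t ∷ height s ∷ ρ} {σ = σ} (suc zero) zero) s⁺t ,
      from (included-correct X Y) s⊆t , lift (from (Y i _) t[s]))

  prepend-Encodes : ∀ {X : Vector Subset n} {s} (σ : Vector Subset l) → X Encodes s →
    prepend X σ ∘ (_↑ˡ l) Encodes s
  prepend-Encodes {X = X} {s} σ X≈s i γ =
    subst (λ Z → Z γ ⇔ (s [ γ ]= i)) (sym (prepend-↑ˡ X σ i)) (X≈s i γ)

  bind-Encodes : ∀ {e : Fin k → Fin n → Fin l} {ρ : Vector (Node n α) k} {X s} →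
    (∀ j → σ ∘ e j Encodes ρ j) → prepend X σ ∘ (_↑ˡ l) Encodes s →
    ∀ j → prepend X σ ∘ bind e j Encodes (s ∷ ρ) j
  bind-Encodes c X≈s zero = X≈s
  bind-Encodes {σ = σ} {e = e} {ρ} {X} c X≈s (suc j) i γ =
    subst (λ Z → Z γ ⇔ (ρ j [ γ ]= i)) (sym (prepend-↑ʳ X σ (e j i))) (c j i γ)

  -- Kept as satisfaction of `isCode`, so that it is literally the guard that `toMSO` attaches to
  -- quantifiers.
  Coded : Vector Subset l → Vector Subset n → Set _
  Coded {l} σ X = α ⊨ᴹ isCode (_↑ˡ l) [ [] ⨾ prepend X σ ]

  code-Coded : ∀ (σ : Vector Subset l) (s : Node n α) →
    ∃ λ X → Coded σ X × (prepend X σ ∘ (_↑ˡ l) Encodes s)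
  code-Coded σ s = code s , from (isCode-correct _) (s , X≈s) , X≈s
    where X≈s = prepend-Encodes σ λ i γ → ⇔-id _

  -- Induction on `φ`. At a quantifier, every node has a code and every guarded tuple decodes to a
  -- node.
  toMSO-correct : ∀ (φ : Formula (ℒᴱ n) k) {e : Fin k → Fin n → Fin l} {ρ} →
    (∀ j → σ ∘ e j Encodes ρ j) → (𝔗ᴱ n α ⊨ φ [ ρ ]) ⇔ (α ⊨ᴹ toMSO φ e [ [] ⨾ σ ])
  toMSO-correct (var i ≐ var j) c = mk⇔
    (λ s≋t → from (included-correct (c i) (c j)) (≋⇒⊆ s≋t) ,
             from (included-correct (c j) (c i)) (≋⇒⊆ (≋-sym s≋t)))
    (λ (p , q) → ⊆-antisym (to (included-correct (c i) (c j)) p)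
                           (to (included-correct (c j) (c i)) q))
  toMSO-correct (rel incl (var i) (var j)) c = ⇔-sym (included-correct (c i) (c j))
  toMSO-correct (rel (edge f) (var i) (var j)) c = ⇔-sym (isEdge-correct f (c i) (c j))
  toMSO-correct bot      c = mk⇔ (λ ()) (λ ())
  toMSO-correct (¬′ φ)   c = ¬-cong-⇔ (toMSO-correct φ c)
  toMSO-correct (φ ∧ ψ)  c = toMSO-correct φ c ×-⇔ toMSO-correct ψ c
  toMSO-correct (φ ∨ ψ)  c = toMSO-correct φ c ⊎-⇔ toMSO-correct ψ c
  toMSO-correct (φ ⇒ ψ)  c = →-cong-⇔ (toMSO-correct φ c) (toMSO-correct ψ c)
  toMSO-correct {n = n} {σ = σ} (all′ φ) c = ⇔-sym (alls-correct n _) ⇔-∘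
    ∀-transfer-guarded (λ s X → prepend X σ ∘ _ Encodes s)
      (code-Coded σ) (λ X → to (isCode-correct _))
      (λ X≈s → toMSO-correct φ (bind-Encodes c X≈s))
  toMSO-correct {n = n} {σ = σ} (ex′ φ) c = ⇔-sym (exs-correct n _) ⇔-∘
    ∃-transfer-guarded (λ s X → prepend X σ ∘ _ Encodes s)
      (code-Coded σ) (λ X → to (isCode-correct _))
      (λ X≈s → toMSO-correct φ (bind-Encodes c X≈s))

  codes-Encodes : (s : Vector (Node n α) k) → ∀ j → codes s ∘ combine j Encodes s j
  codes-Encodes s j i γ =
    subst (λ (j′ , i′) → (s j′ [ γ ]= i′) ⇔ (s j [ γ ]= i)) (sym (remQuot-combine j i)) (⇔-id _)

-- From MSO to trees

-- The inner node `w` is forced to be the restriction of `y` to the height of `u`; `u` itself may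
-- lie off the branch of `y`.
mark : Fin n → (u y : Fin m) → Formula (ℒ∼ n) m
mark i u y = ex′ (ex′ (
  rel sim (var (suc zero)) (var (suc (suc u))) ∧
  rel (edge i) (var (suc zero)) (var zero) ∧
  rel incl (var zero) (var (suc (suc y)))))

-- Meeting is equality for two singletons and membership for a singleton and a set. In `precedes`,
-- the last conjunct forces the first witness to be lower than the second.
meets precedes : Fin n → (y z : Fin m) → Formula (ℒ∼ n) m
meets i y z = ex′ (mark i zero (suc y) ∧ mark i zero (suc z))
precedes i y z = ex′ (ex′ (
  mark i (suc zero) (suc (suc y)) ∧ mark i zero (suc (suc z)) ∧ mark i (suc zero) zero))

-- One position has many names, so uniqueness is stated up to `sim`.
isSingleton : Fin n → Fin m → Formula (ℒ∼ n) m
isSingleton i y = ex′ (mark i zero (suc y)) ∧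
  all′ (all′ (mark i (suc zero) (suc (suc y)) ∧ mark i zero (suc (suc y)) ⇒
    rel sim (var (suc zero)) (var zero)))

toTree : Fin n → MSO k l → (Fin k → Fin m) → (Fin l → Fin m) → Formula (ℒ∼ n) m
toTree i (x ≐ y) e f = meets i (e x) (e y)
toTree i (x ≺ y) e f = precedes i (e x) (e y)
toTree i (x ϵ X) e f = meets i (e x) (f X)
toTree i bot      e f = bot
toTree i (¬′ ψ)   e f = ¬′ toTree i ψ e f
toTree i (ψ ∧ χ)  e f = toTree i ψ e f ∧ toTree i χ e f
toTree i (ψ ∨ χ)  e f = toTree i ψ e f ∨ toTree i χ e f
toTree i (ψ ⇒ χ)  e f = toTree i ψ e f ⇒ toTree i χ e f
toTree i (all₁ ψ) e f = all′ (isSingleton i zero ⇒ toTree i ψ (zero ∷ suc ∘ e) (suc ∘ f))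
toTree i (ex₁ ψ)  e f = ex′ (isSingleton i zero ∧ toTree i ψ (zero ∷ suc ∘ e) (suc ∘ f))
toTree i (all₂ ψ) e f = all′ (toTree i ψ (suc ∘ e) (zero ∷ suc ∘ f))
toTree i (ex₂ ψ)  e f = ex′ (toTree i ψ (suc ∘ e) (zero ∷ suc ∘ f))

-- Correctness of the translation of MSO formulas.

module _ (em : ExcludedMiddle ℓ) (2≤n : 2 ≤ n) (α : Ordinal ℓ) where
  open Ordinal α

  private
    one = fromℕ< 2≤n

    Subset = Pred Carrier ℓ
    Tree = Node n (α +1)
    𝔐 = 𝔗∼ n (α +1)

    variable
      ρ : Vector Carrier k
      σ : Vector Subset l
      s : Vector Tree m

  infix 4 _Represents_

  -- Entries other than 1 and positions at or beyond the height both count as absence.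
  _Represents_ : Tree → Subset → Set ℓ
  z Represents A = ∀ γ → A γ ⇔ (z [ [ γ ] ]= one)

  support : Tree → Subset
  support z γ = z [ [ γ ] ]= one

  c-Represents : ∀ A → c em 2≤n A Represents A
  c-Represents A γ with em {A γ}
  ... | yes Aγ = mk⇔ (λ _ → [ γ ]<⊤⁺ , refl) (λ _ → Aγ)
  ... | no ¬Aγ = mk⇔ (λ Aγ → contradiction Aγ ¬Aγ)
                     (λ (_ , 0≡1) → contradiction 0≡1 (zero≢one 2≤n))
    where
    -- Matching on `2≤n` lets both numerals reduce to constructors.
    zero≢one : ∀ {n} (2≤n : 2 ≤ n) → ¬ fromℕ< (≤-trans (s≤s z≤n) 2≤n) ≡ fromℕ< 2≤n
    zero≢one (s≤s (s≤s z≤n)) ()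

  -- The last entry of the edge's target sits at the height of its source, which is that of `s u`.
  -- Conversely, restrictions of `s y` give the edge.
  mark-correct : ∀ (s : Vector Tree m) u y →
    (𝔐 ⊨ mark one u y [ s ]) ⇔ (s y [ height (s u) ]= one)
  mark-correct s u y = mk⇔
    (λ (w , v , w∼u , (_ , _ , v[w]) , v⊆y) →
      subst (s y [_]= one) w∼u (v⊆y _ _ v[w]))
    ([]=⇒E em (s y))

  -- For v = constant δ, "v(γ) = 1" says γ < δ; this is how precedes expresses the order.
  constant : Ordinal.Carrier (α +1) → Tree
  constant γ = node γ λ _ _ → one

  module _ (s : Vector Tree m) (y z : Fin m) {A B : Subset}
           (yA : s y Represents A) (zB : s z Represents B) where

    meets-correct : (𝔐 ⊨ meets one y z [ s ]) ⇔ ∃ λ γ → A γ × B γ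
    meets-correct = mk⇔
      (λ (u , p , q) → common (height u)
        (to (mark-correct (u ∷ s) zero (suc y)) p)
        (to (mark-correct (u ∷ s) zero (suc z)) q))
      (λ (γ , γ∈A , γ∈B) → let u = constant [ γ ] in u ,
        from (mark-correct (u ∷ s) zero (suc y)) (to (yA γ) γ∈A) ,
        from (mark-correct (u ∷ s) zero (suc z)) (to (zB γ) γ∈B))
      where
      common : ∀ γ → s y [ γ ]= one → s z [ γ ]= one → ∃ λ γ → A γ × B γ
      -- Nothing lies above `⊤⁺`, so no node has an entry there and a common position belongs to α.
      common ⊤⁺    (() , _)
      common [ γ ] p q = γ , from (yA γ) p , from (zB γ) q

    precedes-correct : (𝔐 ⊨ precedes one y z [ s ]) ⇔
                       ∃ λ γ → ∃ λ δ → A γ × B δ × γ < δ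
    precedes-correct = mk⇔
      (λ (u , v , p , q , r) → let s′ = v ∷ u ∷ s in
        ordered (height u) (height v)
          (to (mark-correct s′ (suc zero) (suc (suc y))) p)
          (to (mark-correct s′ zero (suc (suc z))) q)
          (proj₁ (to (mark-correct s′ (suc zero) zero) r)))
      (λ (γ , δ , γ∈A , δ∈B , γ<δ) →
        let u = constant [ γ ]
            v = constant [ δ ]
            s′ = v ∷ u ∷ s
        in u , v ,
          from (mark-correct s′ (suc zero) (suc (suc y))) (to (yA γ) γ∈A) ,
          from (mark-correct s′ zero (suc (suc z))) (to (zB δ) δ∈B) ,
          from (mark-correct s′ (suc zero) zero) ([ γ<δ ] , refl))
      where
      ordered : ∀ γ δ → s y [ γ ]= one → s z [ δ ]= one → Ordinal._<_ (α +1) γ δ →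
                ∃ λ γ → ∃ λ δ → A γ × B δ × γ < δ
      ordered [ γ ] [ δ ] p q [ γ<δ ] = γ , δ , from (yA γ) p , from (zB δ) q , γ<δ
      ordered _     ⊤⁺    p (() , _) _

  isSingleton-correct : ∀ (s : Vector Tree m) y →
    (𝔐 ⊨ isSingleton one y [ s ]) ⇔ ∃ λ β → s y Represents ｛ β ｝
  isSingleton-correct s y = mk⇔
    (λ ((u , p) , unique) →
      let u∈y = to (mark-correct (u ∷ s) zero (suc y)) p in
      extract (height u) u∈y λ γ γ∈y →
        -- Uniqueness speaks of names, so `γ` is first given one.
        let v = constant γ
            s′ = v ∷ u ∷ s
        in unique u v
             (from (mark-correct s′ (suc zero) (suc (suc y))) u∈y ,
              from (mark-correct s′ zero (suc (suc y))) γ∈y))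
    (λ (β , yβ) → let u = constant [ β ] in
      (u , from (mark-correct (u ∷ s) zero (suc y)) (to (yβ β) refl)) ,
      λ u v (p , q) → let s′ = v ∷ u ∷ s in
        unique yβ (height u) (height v)
          (to (mark-correct s′ (suc zero) (suc (suc y))) p)
          (to (mark-correct s′ zero (suc (suc y))) q))
    where
    extract : ∀ β → s y [ β ]= one → (∀ γ → s y [ γ ]= one → β ≡ γ) →
              ∃ λ β → s y Represents ｛ β ｝
    extract ⊤⁺    (() , _)
    extract [ β ] β∈y unique = β , λ γ → mk⇔
      (λ { refl → β∈y }) (λ γ∈y → []-injective (unique [ γ ] γ∈y))
    unique : ∀ {β} → s y Represents ｛ β ｝ →
             ∀ γ δ → s y [ γ ]= one → s y [ δ ]= one → γ ≡ δ
    unique yβ [ γ ] [ δ ] p q = cong [_] (trans (sym (from (yβ γ) p)) (from (yβ δ) q))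
    unique yβ ⊤⁺    _     (() , _)
    unique yβ [ _ ] ⊤⁺    _ (() , _)

  c-singleton : ∀ (s : Vector Tree m) β →
    ∃ λ z → (𝔐 ⊨ isSingleton one zero [ z ∷ s ]) × z Represents ｛ β ｝
  c-singleton s β = z , from (isSingleton-correct (z ∷ s) zero) (β , h) , h
    where
    z = c em 2≤n ｛ β ｝
    h = c-Represents ｛ β ｝

  -- Induction on `ψ` for arbitrary representatives, not just nodes of the form `c`, because node
  -- quantifiers also reach nodes of smaller height.
  toTree-correct : ∀ (ψ : MSO k l) {e : Fin k → Fin m} {f : Fin l → Fin m} →
    (∀ x → s (e x) Represents ｛ ρ x ｝) → (∀ X → s (f X) Represents σ X) →
    (α ⊨ᴹ ψ [ ρ ⨾ σ ]) ⇔ (𝔐 ⊨ toTree one ψ e f [ s ])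
  toTree-correct {s = s} (x ≐ y) hρ hσ = ⇔-sym (meets-correct s _ _ (hρ x) (hρ y)) ⇔-∘
    mk⇔ (λ (lift eq) → _ , eq , refl) (λ { (_ , p , refl) → lift p })
  toTree-correct {s = s} (x ≺ y) hρ hσ = ⇔-sym (precedes-correct s _ _ (hρ x) (hρ y)) ⇔-∘
    mk⇔ (λ (lift lt) → _ , _ , refl , refl , lt) (λ { (_ , _ , refl , refl , lt) → lift lt })
  toTree-correct {s = s} (x ϵ X) hρ hσ = ⇔-sym (meets-correct s _ _ (hρ x) (hσ X)) ⇔-∘
    mk⇔ (λ (lift p) → _ , refl , p) (λ { (_ , refl , p) → lift p })
  toTree-correct bot      hρ hσ = mk⇔ (λ ()) (λ ())
  toTree-correct (¬′ ψ)   hρ hσ = ¬-cong-⇔ (toTree-correct ψ hρ hσ)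
  toTree-correct (ψ ∧ χ)  hρ hσ = toTree-correct ψ hρ hσ ×-⇔ toTree-correct χ hρ hσ
  toTree-correct (ψ ∨ χ)  hρ hσ = toTree-correct ψ hρ hσ ⊎-⇔ toTree-correct χ hρ hσ
  toTree-correct (ψ ⇒ χ)  hρ hσ = →-cong-⇔ (toTree-correct ψ hρ hσ) (toTree-correct χ hρ hσ)
  toTree-correct {s = s} (all₁ ψ) hρ hσ =
    ∀-transfer-guarded (λ β z → z Represents ｛ β ｝)
      (c-singleton s) (λ z → to (isSingleton-correct (z ∷ s) zero))
      (λ h → toTree-correct ψ (λ { zero → h ; (suc x) → hρ x }) hσ)
  toTree-correct {s = s} (ex₁ ψ) hρ hσ =
    ∃-transfer-guarded (λ β z → z Represents ｛ β ｝)
      (c-singleton s) (λ z → to (isSingleton-correct (z ∷ s) zero))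
      (λ h → toTree-correct ψ (λ { zero → h ; (suc x) → hρ x }) hσ)
  toTree-correct (all₂ ψ) hρ hσ =
    ∀-transfer (λ A z → z Represents A)
      -- Every node represents its `support`, so the way back from nodes to sets is total.
      (λ A → c em 2≤n A , c-Represents A) (λ z → support z , λ γ → ⇔-id _)
      (λ h → toTree-correct ψ hρ (λ { zero → h ; (suc X) → hσ X }))
  toTree-correct (ex₂ ψ) hρ hσ =
    ∃-transfer (λ A z → z Represents A)
      (λ A → c em 2≤n A , c-Represents A) (λ z → support z , λ γ → ⇔-id _)
      (λ h → toTree-correct ψ hρ (λ { zero → h ; (suc X) → hσ X }))

theorem24 : ∀ {ℓ} (em : ExcludedMiddle ℓ) (n : ℕ) (2≤n : 2 ≤ n) (α : Ordinal ℓ) →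
  -- trees to MSO, with each S_i understood through its graph
  (∀ {k} (φ : Formula (ℒᴱ n) k) →
     ∃ λ (φ* : MSO 0 (k * n)) → ∀ (s : Vector (Node n α) k) →
       (𝔗ᴱ n α ⊨ φ [ s ]) ⇔ (α ⊨ᴹ φ* [ [] ⨾ codes s ]))
  ×
  -- trees to MSO, with each S_i a function symbol
  ((lim : IsLimit α) → ∀ {k} (φ : Formula (ℒ n) k) →
     ∃ λ (φ* : MSO 0 (k * n)) → ∀ (s : Vector (Node n α) k) →
       (𝔗 n α lim ⊨ φ [ s ]) ⇔ (α ⊨ᴹ φ* [ [] ⨾ codes s ]))
  ×
  -- MSO to trees
  (∀ {k l} (ψ : MSO k l) →
     ∃ λ (ψ* : Formula (ℒ∼ n) (k + l)) →
       ∀ (β : Vector (Ordinal.Carrier α) k) (A : Vector (Pred (Ordinal.Carrier α) ℓ) l) →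
         (α ⊨ᴹ ψ [ β ⨾ A ]) ⇔ (𝔗∼ n (α +1) ⊨ ψ* [ (λ j → c em 2≤n ｛ β j ｝) ++ (λ j → c em 2≤n (A j)) ]))
theorem24 em n 2≤n α =
  -- `combine` yields the index at which `codes` keeps the `i`-th set of node `j`.
  (λ φ → toMSO φ combine , λ s → toMSO-correct α φ (codes-Encodes α s)) ,
  (λ lim φ → toMSO (unnest φ) combine , λ s →
    toMSO-correct α (unnest φ) (codes-Encodes α s) ⇔-∘ unnest-correct lim φ s) ,
  (λ {k} {l} ψ → toTree (fromℕ< 2≤n) ψ (_↑ˡ l) (k ↑ʳ_) , λ β A →
    let elements = λ j → c em 2≤n {α} ｛ β j ｝
        sets     = λ j → c em 2≤n {α} (A j)
        represents = _Represents_ em 2≤n α in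
    toTree-correct em 2≤n α ψ
      -- Element nodes precede set nodes in the assignment, matching `_↑ˡ l` and `k ↑ʳ_`.
      (λ x → subst (λ z → represents z ｛ β x ｝)
        (sym (lookup-++ˡ elements sets x)) (c-Represents em 2≤n α _))
      (λ X → subst (λ z → represents z (A X))
        (sym (lookup-++ʳ elements sets X)) (c-Represents em 2≤n α _)))
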